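{- PHOML is consistent: there is no proof $\delta$ such that $\langle\rangle \vdash \delta : \bot$, where $\langle\rangle$ is the empty context.
   Context: **Syntax.** Fix three pairwise disjoint infinite sets of variables: term variables ($x,y$), proof variables ($p,q$), path variables ($e$). Types: $A,B,C ::= \Omega \mid A\to B$. Terms: $L,M,N,\varphi,\psi,\chi ::= x\mid\bot\mid\varphi\supset\psi\mid\lambda x{:}A.M\mid MN$. Proofs: $\delta,\epsilon ::= p\mid\lambda p{:}\varphi.\delta\mid\delta\epsilon\mid P^+\mid P^-$. Paths: $P,Q ::= e\mid \mathrm{ref}(M)\mid P\supset^*Q\mid\mathrm{univ}_{\varphi,\psi}(\delta,\epsilon)\mid \lambda\!\!\lambda\!\!\lambda e{:}x=_Ay.P\mid P_{MN}Q$. Contexts: $\Gamma ::= \langle\rangle\mid\Gamma,x:A\mid\Gamma,p:\varphi\mid\Gamma,e:M=_AN$, the declared variables being distinct. Greek and Roman letters both range over terms, with no formal difference. In $\lambda x{:}A.M$, $x$ is bound in $M$; in $\lambda p{:}\varphi.\delta$, $p$ is bound in $\delta$; in $\lambda\!\!\lambda\!\!\lambda e{:}x=_Ay.P$ the variables $x\not\equiv y$ and $e$ are bound in $P$. Expressions are identified up to $\alpha$-conversion; $M[x:=N]$ is capture-avoiding substitution. **Conversion of terms.** Reduction $\to$ on terms is inductively defined by: $(\lambda x{:}A.M)N\to M[x:=N]$; $MN\to M'N$ if $M\to M'$; $\varphi\supset\psi\to\varphi'\supset\psi$ if $\varphi\to\varphi'$; $\varphi\supset\psi\to\varphi\supset\psi'$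 if $\psi\to\psi'$. $\simeq$ is the reflexive symmetric transitive closure of $\to$. **Rules of deduction** (premises $\Rightarrow$ conclusion). Contexts: $\langle\rangle\vdash\mathrm{valid}$; $\Gamma\vdash\mathrm{valid}\Rightarrow\Gamma,x:A\vdash\mathrm{valid}$; $\Gamma\vdash\varphi:\Omega\Rightarrow\Gamma,p:\varphi\vdash\mathrm{valid}$; $\Gamma\vdash M:A,\ \Gamma\vdash N:A\Rightarrow\Gamma,e:M=_AN\vdash\mathrm{valid}$; if $\Gamma\vdash\mathrm{valid}$ then $\Gamma\vdash x:A$, $\Gamma\vdash p:\varphi$, $\Gamma\vdash e:M=_AN$ for the respective entries in $\Gamma$. Terms: $\Gamma\vdash\mathrm{valid}\Rightarrow\Gamma\vdash\bot:\Omega$; $\Gamma\vdash\varphi:\Omega,\ \Gamma\vdash\psi:\Omega\Rightarrow\Gamma\vdash\varphi\supset\psi:\Omega$; $\Gamma\vdash M:A\to B,\ \Gamma\vdash N:A\Rightarrow\Gamma\vdash MN:B$; $\Gamma,x:A\vdash M:B\Rightarrow\Gamma\vdash\lambda x{:}A.M:A\to B$. Proofs: $\Gamma\vdash\delta:\varphi\supset\psi,\ \Gamma\vdash\epsilon:\varphi\Rightarrow\Gamma\vdash\delta\epsilon:\psi$; $\Gamma,p:\varphi\vdash\delta:\psi\Rightarrow\Gamma\vdash\lambda p{:}\varphi.\delta:\varphi\supset\psi$; $\Gamma\vdash\delta:\varphi,\ \Gamma\vdash\psi:\Omega,\ \varphi\simeq\psi\Rightarrow\Gamma\vdash\delta:\psi$.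 Paths: $\Gamma\vdash M:A\Rightarrow\Gamma\vdash\mathrm{ref}(M):M=_AM$; $\Gamma\vdash P:\varphi=_\Omega\varphi',\ \Gamma\vdash Q:\psi=_\Omega\psi'\Rightarrow\Gamma\vdash P\supset^*Q:\varphi\supset\psi=_\Omega\varphi'\supset\psi'$; $\Gamma\vdash\delta:\varphi\supset\psi,\ \Gamma\vdash\epsilon:\psi\supset\varphi\Rightarrow\Gamma\vdash\mathrm{univ}_{\varphi,\psi}(\delta,\epsilon):\varphi=_\Omega\psi$; $\Gamma\vdash P:\varphi=_\Omega\psi\Rightarrow\Gamma\vdash P^+:\varphi\supset\psi$; $\Gamma\vdash P:\varphi=_\Omega\psi\Rightarrow\Gamma\vdash P^-:\psi\supset\varphi$; $\Gamma,x:A,y:A,e:x=_Ay\vdash P:Mx=_BNy,\ \Gamma\vdash M:A\to B,\ \Gamma\vdash N:A\to B\Rightarrow\Gamma\vdash\lambda\!\!\lambda\!\!\lambda e{:}x=_Ay.P:M=_{A\to B}N$; $\Gamma\vdash P:M=_{A\to B}M',\ \Gamma\vdash Q:N=_AN',\ \Gamma\vdash N:A,\ \Gamma\vdash N':A\Rightarrow\Gamma\vdash P_{NN'}Q:MN=_BM'N'$; $\Gamma\vdash P:M=_AN,\ \Gamma\vdash M':A,\ \Gamma\vdash N':A,\ M\simeq M',\ N\simeq N'\Rightarrow\Gamma\vdash P:M'=_AN'$. -}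

module Defs where

open import Data.List using (List; []; _∷_)
open import Data.List.Membership.Propositional using (_∈_)
open import Data.List.Relation.Unary.Any using (here; there)
open import Relation.Binary.Construct.Closure.Equivalence using (EqClosure)
open import Relation.Binary.PropositionalEquality using (refl)

-- Well-scoped de Bruijn syntax: expressions up to α-conversion.  A scope
-- lists the kinds of the variables that may occur free, the most recently
-- declared first; the three kinds are the three disjoint sorts of variables.

data Kind : Set where
  term proof path : Kind

Scope : Set
Scope = List Kind

private
  variable
    V W : Scope
    K L : Kind

infixr 6 _⇒_

data Type : Set where
  Ω   : Type
  _⇒_ : Type → Type → Type

private
  variable
    A B : Type

infixr 6 _⊃_ _⊃*_
infixl 8 _·_ _∙_
infix  9 _⁺ _⁻

data Expr (V : Scope) : Kind → Set where
  var : K ∈ V → Expr V K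

  ⊥′  : Expr V term
  _⊃_ : (φ ψ : Expr V term) → Expr V term
  ƛ   : (A : Type) (M : Expr (term ∷ V) term) → Expr V term
  _·_ : (M N : Expr V term) → Expr V term

  Λ   : (φ : Expr V term) (δ : Expr (proof ∷ V) proof) → Expr V proof
  _∙_ : (δ ε : Expr V proof) → Expr V proof
  _⁺  : (P : Expr V path) → Expr V proof
  _⁻  : (P : Expr V path) → Expr V proof

  ref  : (M : Expr V term) → Expr V path
  _⊃*_ : (P Q : Expr V path) → Expr V path
  univ : (φ ψ : Expr V term) (δ ε : Expr V proof) → Expr V path
  -- λλλ A P is λλλ e : x =_A y . P.  Index 0 of P is e, 1 is y and 2 is x.
  λλλ  : (A : Type) (P : Expr (path ∷ term ∷ term ∷ V) path) → Expr V path
  -- app* M N P Q is P applied to Q with subscripts M and N, P_{MN} Q.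
  app* : (M N : Expr V term) (P Q : Expr V path) → Expr V path

Term Proof Path : Scope → Set
Term  V = Expr V term
Proof V = Expr V proof
Path  V = Expr V path

private
  variable
    φ φ′ ψ ψ′ M M′ N N′ : Term V
    δ ε                 : Proof V
    P Q                 : Path V

-- Proof and path variables do not occur in terms, and the rules of deduction
-- only ever rename or substitute in terms, so these operations act on term
-- variables only.

Ren : Scope → Scope → Set
Ren V W = term ∈ V → term ∈ W

lift : Ren V W → Ren (term ∷ V) (term ∷ W)
lift ρ (here refl) = here refl
lift ρ (there x)   = there (ρ x)

ren : Ren V W → Term V → Term W
ren ρ (var x) = var (ρ x)
ren ρ ⊥′      = ⊥′
ren ρ (φ ⊃ ψ) = ren ρ φ ⊃ ren ρ ψ
ren ρ (ƛ A M) = ƛ A (ren (lift ρ) M)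
ren ρ (M · N) = ren ρ M · ren ρ N

wk : Term V → Term (K ∷ V)
wk = ren there

Sub : Scope → Scope → Set
Sub V W = term ∈ V → Term W

lifts : Sub V W → Sub (term ∷ V) (term ∷ W)
lifts σ (here refl) = var (here refl)
lifts σ (there x)   = wk (σ x)

sub : Sub V W → Term V → Term W
sub σ (var x) = σ x
sub σ ⊥′      = ⊥′
sub σ (φ ⊃ ψ) = sub σ φ ⊃ sub σ ψ
sub σ (ƛ A M) = ƛ A (sub (lifts σ) M)
sub σ (M · N) = sub σ M · sub σ N

inst : Term V → Sub (term ∷ V) V
inst N (here refl) = N
inst N (there x)   = var x

infix 9 _[_]

_[_] : Term (term ∷ V) → Term V → Term V
M [ N ] = sub (inst N) M

infix 4 _⟶_ _≃_

-- There is no congruence rule for ƛ or for the argument of an application.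
data _⟶_ {V : Scope} : Term V → Term V → Set where
  β  : ∀ {M} → ƛ A M · N ⟶ M [ N ]
  ·ˡ : M ⟶ M′ → M · N ⟶ M′ · N
  ⊃ˡ : φ ⟶ φ′ → φ ⊃ ψ ⟶ φ′ ⊃ ψ
  ⊃ʳ : ψ ⟶ ψ′ → φ ⊃ ψ ⟶ φ ⊃ ψ′

_≃_ : Term V → Term V → Set
_≃_ = EqClosure _⟶_

infix 5 _＝⟨_⟩_

-- What an expression of each kind is classified by: a term by a type, a proof
-- by a proposition, a path by an equation M =_A N.
data Class (V : Scope) : Kind → Set where
  ty      : Type → Class V term
  prf     : Term V → Class V proof
  _＝⟨_⟩_ : Term V → Type → Term V → Class V path

wkClass : Class V K → Class (L ∷ V) K
wkClass (ty A)        = ty A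
wkClass (prf φ)       = prf (wk φ)
wkClass (M ＝⟨ A ⟩ N) = wk M ＝⟨ A ⟩ wk N

infixl 4 _,_

data Ctx : Scope → Set where
  ⟨⟩  : Ctx []
  _,_ : Ctx V → Class V K → Ctx (K ∷ V)

private
  variable
    Γ : Ctx V

lookup : Ctx V → K ∈ V → Class V K
lookup (Γ , T) (here refl) = wkClass T
lookup (Γ , T) (there x)   = wkClass (lookup Γ x)

infix 3 _⊢valid _⊢_∶_

mutual

  data _⊢valid : Ctx V → Set where
    ⟨⟩-valid   : ⟨⟩ ⊢valid
    ty-valid   : Γ ⊢valid → Γ , ty A ⊢valid
    prf-valid  : Γ ⊢ φ ∶ ty Ω → Γ , prf φ ⊢valid
    path-valid : Γ ⊢ M ∶ ty A → Γ ⊢ N ∶ ty A → Γ , M ＝⟨ A ⟩ N ⊢valid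

  data _⊢_∶_ {V : Scope} (Γ : Ctx V) : Expr V K → Class V K → Set where
    ⊢var : Γ ⊢valid → (x : K ∈ V) → Γ ⊢ var x ∶ lookup Γ x

    ⊢⊥ : Γ ⊢valid → Γ ⊢ ⊥′ ∶ ty Ω
    ⊢⊃ : Γ ⊢ φ ∶ ty Ω → Γ ⊢ ψ ∶ ty Ω → Γ ⊢ φ ⊃ ψ ∶ ty Ω
    ⊢· : Γ ⊢ M ∶ ty (A ⇒ B) → Γ ⊢ N ∶ ty A → Γ ⊢ M · N ∶ ty B
    ⊢ƛ : ∀ {M} → Γ , ty A ⊢ M ∶ ty B → Γ ⊢ ƛ A M ∶ ty (A ⇒ B)

    ⊢∙     : Γ ⊢ δ ∶ prf (φ ⊃ ψ) → Γ ⊢ ε ∶ prf φ → Γ ⊢ δ ∙ ε ∶ prf ψ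
    ⊢Λ     : ∀ {δ} → Γ , prf φ ⊢ δ ∶ prf (wk ψ) → Γ ⊢ Λ φ δ ∶ prf (φ ⊃ ψ)
    ⊢convₚ : Γ ⊢ δ ∶ prf φ → Γ ⊢ ψ ∶ ty Ω → φ ≃ ψ → Γ ⊢ δ ∶ prf ψ

    ⊢ref  : Γ ⊢ M ∶ ty A → Γ ⊢ ref M ∶ M ＝⟨ A ⟩ M
    ⊢⊃*   : Γ ⊢ P ∶ φ ＝⟨ Ω ⟩ φ′ → Γ ⊢ Q ∶ ψ ＝⟨ Ω ⟩ ψ′ →
            Γ ⊢ P ⊃* Q ∶ φ ⊃ ψ ＝⟨ Ω ⟩ φ′ ⊃ ψ′
    ⊢univ : Γ ⊢ δ ∶ prf (φ ⊃ ψ) → Γ ⊢ ε ∶ prf (ψ ⊃ φ) →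
            Γ ⊢ univ φ ψ δ ε ∶ φ ＝⟨ Ω ⟩ ψ
    ⊢⁺    : Γ ⊢ P ∶ φ ＝⟨ Ω ⟩ ψ → Γ ⊢ P ⁺ ∶ prf (φ ⊃ ψ)
    ⊢⁻    : Γ ⊢ P ∶ φ ＝⟨ Ω ⟩ ψ → Γ ⊢ P ⁻ ∶ prf (ψ ⊃ φ)
    ⊢λλλ  : ∀ {P} →
            Γ , ty A , ty A , var (there (here refl)) ＝⟨ A ⟩ var (here refl)
              ⊢ P
              ∶ wk (wk (wk M)) · var (there (there (here refl)))
                  ＝⟨ B ⟩
                wk (wk (wk N)) · var (there (here refl)) →
            Γ ⊢ M ∶ ty (A ⇒ B) → Γ ⊢ N ∶ ty (A ⇒ B) →
            Γ ⊢ λλλ A P ∶ M ＝⟨ A ⇒ B ⟩ N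
    ⊢app* : Γ ⊢ P ∶ M ＝⟨ A ⇒ B ⟩ M′ → Γ ⊢ Q ∶ N ＝⟨ A ⟩ N′ →
            Γ ⊢ N ∶ ty A → Γ ⊢ N′ ∶ ty A →
            Γ ⊢ app* N N′ P Q ∶ M · N ＝⟨ B ⟩ M′ · N′
    ⊢conv : Γ ⊢ P ∶ M ＝⟨ A ⟩ N → Γ ⊢ M′ ∶ ty A → Γ ⊢ N′ ∶ ty A →
            M ≃ M′ → N ≃ N′ → Γ ⊢ P ∶ M′ ＝⟨ A ⟩ N′

{-# OPTIONS --safe #-}

-- Closed terms carry a truth-table semantics: a closed proposition may evaluate
-- to a Boolean, and evaluation is invariant under ⟶ in both directions.  Equality
-- of truth values at Ω extends to a partial equivalence relation at every type by
-- M ∼ M′ iff N ∼ N′ implies M · N ∼ M′ · N′.  Typable terms are related to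
-- themselves, provable propositions evaluate to true, and paths have related
-- endpoints: univ is sound because equivalent propositions have the same truth
-- value, and λλλ because it is the definition of ∼ at a function type.  Since ⊥′
-- evaluates to false only, it has no proof.
module Submission where

open import Defs renaming (_,_ to infixl 4 _▹_)
open import Data.Bool using (Bool; true; false; not; _∨_)
open import Data.List using ([]; _∷_)
open import Data.List.Membership.Propositional using (_∈_)
open import Data.List.Relation.Unary.Any using (here; there)
open import Data.Product using (Σ-syntax; ∃-syntax; _×_; _,_; proj₁; proj₂)
open import Data.Sum using (_⊎_; inj₁; inj₂)
open import Data.Unit using (⊤; tt)
open import Function using (_∘_)
open import Relation.Binary.Construct.Closure.Equivalence using (gmap)
open import Relation.Binary.Construct.Closure.ReflexiveTransitive using (ε; _◅_)
open import Relation.Binary.Construct.Closure.Symmetric using (fwd; bwd)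
open import Relation.Binary.PropositionalEquality
  using (_≡_; _≗_; refl; sym; trans; cong; cong₂; subst; subst₂)
open import Relation.Nullary using (¬_)

private
  variable
    U V W : Scope
    K L   : Kind
    A B   : Type
    b c   : Bool

-- Renaming and substitution

sub-var : {σ : Sub V V} → σ ≗ var → (M : Term V) → sub σ M ≡ M
sub-var e (var x) = e x
sub-var e ⊥′      = refl
sub-var e (φ ⊃ ψ) = cong₂ _⊃_ (sub-var e φ) (sub-var e ψ)
sub-var e (ƛ A M) =
  cong (ƛ A) (sub-var (λ { (here refl) → refl ; (there x) → cong wk (e x) }) M)
sub-var e (M · N) = cong₂ _·_ (sub-var e M) (sub-var e N)

ren-as-sub : {ρ : Ren V W} {σ : Sub V W} → var ∘ ρ ≗ σ → ren ρ ≗ sub σ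
ren-as-sub e (var x) = e x
ren-as-sub e ⊥′      = refl
ren-as-sub e (φ ⊃ ψ) = cong₂ _⊃_ (ren-as-sub e φ) (ren-as-sub e ψ)
ren-as-sub e (ƛ A M) =
  cong (ƛ A) (ren-as-sub (λ { (here refl) → refl ; (there x) → cong wk (e x) }) M)
ren-as-sub e (M · N) = cong₂ _·_ (ren-as-sub e M) (ren-as-sub e N)

-- The composite is a third map known only pointwise, so the induction passes under `ƛ` without
-- function extensionality. `ren-sub` and `sub-sub` follow the same pattern.
sub-ren : {ρ : Ren U V} {σ : Sub V W} {τ : Sub U W} →
          σ ∘ ρ ≗ τ → sub σ ∘ ren ρ ≗ sub τ
sub-ren e (var x) = e x
sub-ren e ⊥′      = refl
sub-ren e (φ ⊃ ψ) = cong₂ _⊃_ (sub-ren e φ) (sub-ren e ψ)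
sub-ren e (ƛ A M) =
  cong (ƛ A) (sub-ren (λ { (here refl) → refl ; (there x) → cong wk (e x) }) M)
sub-ren e (M · N) = cong₂ _·_ (sub-ren e M) (sub-ren e N)

-- Viewing renamings as substitutions turns both sides into one and the same substitution applied to
-- `M`.
lift-wk : (ρ : Ren V W) (M : Term V) → ren (lift ρ) (wk {K = term} M) ≡ wk (ren ρ M)
lift-wk ρ M =
  trans (ren-as-sub (λ _ → refl) (wk M))
        (trans (sub-ren (λ _ → refl) M) (sym wk-ren))
  where
  wk-ren : wk (ren ρ M) ≡ sub (var ∘ there ∘ ρ) M
  wk-ren = trans (ren-as-sub (λ _ → refl) (ren ρ M)) (sub-ren (λ _ → refl) M)

ren-sub : {ρ : Ren V W} {σ : Sub U V} {τ : Sub U W} →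
          ren ρ ∘ σ ≗ τ → ren ρ ∘ sub σ ≗ sub τ
ren-sub e (var x) = e x
ren-sub e ⊥′      = refl
ren-sub e (φ ⊃ ψ) = cong₂ _⊃_ (ren-sub e φ) (ren-sub e ψ)
ren-sub {ρ = ρ} {σ} e (ƛ A M) =
  cong (ƛ A) (ren-sub (λ { (here refl) → refl
                         ; (there x) → trans (lift-wk ρ (σ x)) (cong wk (e x)) }) M)
ren-sub e (M · N) = cong₂ _·_ (ren-sub e M) (ren-sub e N)

lifts-wk : (σ : Sub V W) (M : Term V) →
           sub (lifts σ) (wk M) ≡ wk (sub σ M)
lifts-wk σ M =
  trans (sub-ren (λ _ → refl) M) (sym (ren-sub (λ _ → refl) M))

sub-sub : {σ : Sub U V} {τ : Sub V W} {υ : Sub U W} →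
          sub τ ∘ σ ≗ υ → sub τ ∘ sub σ ≗ sub υ
sub-sub e (var x) = e x
sub-sub e ⊥′      = refl
sub-sub e (φ ⊃ ψ) = cong₂ _⊃_ (sub-sub e φ) (sub-sub e ψ)
sub-sub {σ = σ} {τ} e (ƛ A M) =
  cong (ƛ A) (sub-sub (λ { (here refl) → refl
                         ; (there x) → trans (lifts-wk τ (σ x)) (cong wk (e x)) }) M)
sub-sub e (M · N) = cong₂ _·_ (sub-sub e M) (sub-sub e N)

infixl 5 _▸_

_▸_ : Sub V W → Term W → Sub (term ∷ V) W
(σ ▸ N) (here refl) = N
(σ ▸ N) (there x)   = σ x

-- Junk at K = term: only K = proof and K = path are used, where no index 0 is a term.
skip : Sub V W → Sub (K ∷ V) W
skip σ (here refl) = ⊥′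
skip σ (there x)   = σ x

wk-inst : (N M : Term V) → sub (inst N) (wk M) ≡ M
wk-inst N M = trans (sub-ren (λ _ → refl) M) (sub-var (λ _ → refl) M)

lifts-inst : (σ : Sub V W) (N : Term W) (M : Term (term ∷ V)) →
             sub (lifts σ) M [ N ] ≡ sub (σ ▸ N) M
lifts-inst σ N =
  sub-sub (λ { (here refl) → refl ; (there x) → wk-inst N (σ x) })

-- Both sides are `M` under `σ ▸ sub σ N`. This is the β case of stability of reduction under
-- substitution.
sub-inst : (σ : Sub V W) (M : Term (term ∷ V)) (N : Term V) →
           sub (lifts σ) M [ sub σ N ] ≡ sub σ (M [ N ])
sub-inst σ M N =
  trans (lifts-inst σ (sub σ N) M)
        (sym (sub-sub (λ { (here refl) → refl ; (there x) → refl }) M))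

sub-⟶ : (σ : Sub V W) {M N : Term V} → M ⟶ N → sub σ M ⟶ sub σ N
sub-⟶ σ (β {A = A} {N = N} {M = M}) =
  subst (sub σ (ƛ A M · N) ⟶_) (sub-inst σ M N) β
sub-⟶ σ (·ˡ r) = ·ˡ (sub-⟶ σ r)
sub-⟶ σ (⊃ˡ r) = ⊃ˡ (sub-⟶ σ r)
sub-⟶ σ (⊃ʳ r) = ⊃ʳ (sub-⟶ σ r)

sub-≃ : (σ : Sub V W) {M N : Term V} → M ≃ N → sub σ M ≃ sub σ N
sub-≃ σ = gmap (sub σ) (sub-⟶ σ)

-- Evaluation of propositions

-- A β-redex has no other reduct, since nothing reduces under `ƛ` or in an argument. Only steps on
-- opposite sides of `⊃` can diverge, and these commute.
⟶-diamond : {M N₁ N₂ : Term V} → M ⟶ N₁ → M ⟶ N₂ →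
            N₁ ≡ N₂ ⊎ ∃[ N ] N₁ ⟶ N × N₂ ⟶ N
⟶-diamond β      β      = inj₁ refl
⟶-diamond (·ˡ r) (·ˡ s) with ⟶-diamond r s
... | inj₁ refl          = inj₁ refl
... | inj₂ (_ , s′ , r′) = inj₂ (_ , ·ˡ s′ , ·ˡ r′)
⟶-diamond (⊃ˡ r) (⊃ˡ s) with ⟶-diamond r s
... | inj₁ refl          = inj₁ refl
... | inj₂ (_ , s′ , r′) = inj₂ (_ , ⊃ˡ s′ , ⊃ˡ r′)
⟶-diamond (⊃ʳ r) (⊃ʳ s) with ⟶-diamond r s
... | inj₁ refl          = inj₁ refl
... | inj₂ (_ , s′ , r′) = inj₂ (_ , ⊃ʳ s′ , ⊃ʳ r′)
⟶-diamond (⊃ˡ r) (⊃ʳ s) = inj₂ (_ , ⊃ʳ s , ⊃ˡ r)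
⟶-diamond (⊃ʳ r) (⊃ˡ s) = inj₂ (_ , ⊃ˡ s , ⊃ʳ r)

infix 4 _⇓_

-- A relation rather than a function, since an arbitrary term need not have a value. `step` builds
-- in invariance under expansion, so only invariance under reduction remains to be proved.
data _⇓_ {V : Scope} : Term V → Bool → Set where
  ⇓⊥   : ⊥′ ⇓ false
  ⇓⊃   : ∀ {φ ψ} → φ ⇓ b → ψ ⇓ c → φ ⊃ ψ ⇓ not b ∨ c
  step : ∀ {M N} → M ⟶ N → N ⇓ b → M ⇓ b

⇓-⟶ : {M N : Term V} → M ⟶ N → M ⇓ b → N ⇓ b
⇓-⟶ (⊃ˡ r) (⇓⊃ d e) = ⇓⊃ (⇓-⟶ r d) e
⇓-⟶ (⊃ʳ r) (⇓⊃ d e) = ⇓⊃ d (⇓-⟶ r e)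
⇓-⟶ r (step s d) with ⟶-diamond s r
... | inj₁ refl          = d
... | inj₂ (_ , r′ , s′) = step s′ (⇓-⟶ r′ d)

-- A step from an implication takes place in one of its sides, so it can be pushed into the
-- evaluation of that side.
⇓⊃-inv : {φ ψ : Term V} → φ ⊃ ψ ⇓ b →
         ∃[ c ] ∃[ d ] φ ⇓ c × ψ ⇓ d × b ≡ not c ∨ d
⇓⊃-inv (⇓⊃ d e) = _ , _ , d , e , refl
⇓⊃-inv (step (⊃ˡ r) d) with ⇓⊃-inv d
... | _ , _ , d₁ , d₂ , eq = _ , _ , step r d₁ , d₂ , eq
⇓⊃-inv (step (⊃ʳ r) d) with ⇓⊃-inv d
... | _ , _ , d₁ , d₂ , eq = _ , _ , d₁ , step r d₂ , eq

⇓-det : {M : Term V} → M ⇓ b → M ⇓ c → b ≡ c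
⇓-det ⇓⊥         ⇓⊥ = refl
⇓-det (⇓⊃ d e)   f with ⇓⊃-inv f
... | _ , _ , d′ , e′ , refl rewrite ⇓-det d d′ | ⇓-det e e′ = refl
⇓-det (step r d) e = ⇓-det d (⇓-⟶ r e)

⇓-mp : {φ ψ : Term V} → φ ⊃ ψ ⇓ true → φ ⇓ true → ψ ⇓ true
⇓-mp d e with ⇓⊃-inv d
... | _ , _ , e′ , f , eq with ⇓-det e e′
⇓-mp d e | _ , _ , e′ , f , refl | refl = f

-- The logical relation

infix 4 _∼[_]_

_∼[_]_ : Term V → Type → Term V → Set
M ∼[ Ω ]     N  = ∃[ b ] M ⇓ b × N ⇓ b
M ∼[ A ⇒ B ] M′ = ∀ {N N′} → N ∼[ A ] N′ → M · N ∼[ B ] M′ · N′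

∼-sym : ∀ A {M N : Term V} → M ∼[ A ] N → N ∼[ A ] M
∼-sym Ω       (_ , d , e) = _ , e , d
∼-sym (A ⇒ B) r s         = ∼-sym B (r (∼-sym A s))

∼-trans : ∀ A {L M N : Term V} → L ∼[ A ] M → M ∼[ A ] N → L ∼[ A ] N
∼-trans Ω (_ , d , e) (_ , e′ , f) with ⇓-det e e′
... | refl = _ , d , f
-- The change of argument is made by `r`; `s` then compares the functions at the right-hand
-- argument, which is related to itself by symmetry and transitivity at `A`.
∼-trans (A ⇒ B) r s t = ∼-trans B (r t) (s (∼-trans A (∼-sym A t) t))

∼-reflˡ : ∀ A {M N : Term V} → M ∼[ A ] N → M ∼[ A ] M
∼-reflˡ A r = ∼-trans A r (∼-sym A r)

∼-reflʳ : ∀ A {M N : Term V} → M ∼[ A ] N → N ∼[ A ] N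
∼-reflʳ A r = ∼-trans A (∼-sym A r) r

-- Reduction in function position suffices to carry a step through any number of arguments down to
-- `Ω`.
∼-⟶ : ∀ A {M M′ N : Term V} → M ⟶ M′ → M ∼[ A ] N → M′ ∼[ A ] N
∼-⟶ Ω       r (_ , d , e) = _ , ⇓-⟶ r d , e
∼-⟶ (A ⇒ B) r s t         = ∼-⟶ B (·ˡ r) (s t)

∼-⟵ : ∀ A {M M′ N : Term V} → M′ ⟶ M → M ∼[ A ] N → M′ ∼[ A ] N
∼-⟵ Ω       r (_ , d , e) = _ , step r d , e
∼-⟵ (A ⇒ B) r s t         = ∼-⟵ B (·ˡ r) (s t)

∼-≃ˡ : ∀ A {M M′ N : Term V} → M ≃ M′ → M ∼[ A ] N → M′ ∼[ A ] N
∼-≃ˡ A ε            s = s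
∼-≃ˡ A (fwd r ◅ rs) s = ∼-≃ˡ A rs (∼-⟶ A r s)
∼-≃ˡ A (bwd r ◅ rs) s = ∼-≃ˡ A rs (∼-⟵ A r s)

∼-≃ : ∀ A {M M′ N N′ : Term V} → M ≃ M′ → N ≃ N′ → M ∼[ A ] N → M′ ∼[ A ] N′
∼-≃ A r s t = ∼-sym A (∼-≃ˡ A s (∼-sym A (∼-≃ˡ A r t)))

⇓-≃ : {M N : Term V} → M ≃ N → M ⇓ b → N ⇓ b
⇓-≃ r d with ∼-≃ Ω r ε (_ , d , d)
... | _ , e , d′ with ⇓-det d d′
... | refl = e

-- Soundness

Env : Ctx V → Sub V W → Sub V W → Set
Env ⟨⟩                σ τ = ⊤
Env (Γ ▹ ty A)        σ τ =
  Env Γ (σ ∘ there) (τ ∘ there) × σ (here refl) ∼[ A ] τ (here refl)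
Env (Γ ▹ prf _)       σ τ = Env Γ (σ ∘ there) (τ ∘ there)
Env (Γ ▹ _ ＝⟨ _ ⟩ _) σ τ = Env Γ (σ ∘ there) (τ ∘ there)

Env-tail : (Γ : Ctx V) (T : Class V K) {σ τ : Sub (K ∷ V) W} →
           Env (Γ ▹ T) σ τ → Env Γ (σ ∘ there) (τ ∘ there)
Env-tail Γ (ty _)        = proj₁
Env-tail Γ (prf _)       ρ = ρ
Env-tail Γ (_ ＝⟨ _ ⟩ _) ρ = ρ

-- Environments need not satisfy the hypotheses of the context.  This is what
-- makes φ ⊃ ψ have a truth value even when φ is false.  Two environments are
-- compared for terms only: an implication determines the truth values of its two
-- sides under one environment, but not that they agree under two.
WellDefined : Sub V W → Sub V W → Expr V K → Class V K → Set
WellDefined σ τ M (ty A)        = sub σ M ∼[ A ] sub τ M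
WellDefined σ τ _ (prf φ)       = sub σ φ ∼[ Ω ] sub σ φ
WellDefined σ τ _ (M ＝⟨ A ⟩ N) = sub σ M ∼[ A ] sub σ M × sub σ N ∼[ A ] sub σ N

Holds : Sub V W → Class V K → Set
Holds σ (ty A)        = ⊤
Holds σ (prf φ)       = sub σ φ ⇓ true
Holds σ (M ＝⟨ A ⟩ N) = sub σ M ∼[ A ] sub σ N

Hyps : Ctx V → Sub V W → Set
Hyps ⟨⟩      σ = ⊤
Hyps (Γ ▹ T) σ = Hyps Γ (σ ∘ there) × Holds (σ ∘ there) T

sub-wk : (σ : Sub (K ∷ V) W) (M : Term V) → sub (σ ∘ there) M ≡ sub σ (wk M)
sub-wk σ M = sym (sub-ren (λ _ → refl) M)

WellDefined-wk : (T : Class V K) (x : K ∈ V) {σ τ : Sub (L ∷ V) W} →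
                 WellDefined (σ ∘ there) (τ ∘ there) (var x) T →
                 WellDefined σ τ (var (there x)) (wkClass T)
WellDefined-wk (ty A)        x     w = w
WellDefined-wk (prf φ)       x {σ} w = subst (λ φ → φ ∼[ Ω ] φ) (sub-wk σ φ) w
WellDefined-wk (M ＝⟨ A ⟩ N) x {σ} (w₁ , w₂) =
  subst (λ M → M ∼[ A ] M) (sub-wk σ M) w₁ , subst (λ N → N ∼[ A ] N) (sub-wk σ N) w₂

Holds-wk : (T : Class V K) {σ : Sub (L ∷ V) W} →
           Holds (σ ∘ there) T → Holds σ (wkClass T)
Holds-wk (ty A)        h     = tt
Holds-wk (prf φ)       {σ}   = subst (_⇓ true) (sub-wk σ φ)
Holds-wk (M ＝⟨ A ⟩ N) {σ}   = subst₂ _∼[ A ]_ (sub-wk σ M) (sub-wk σ N)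

-- `Env` constrains term variables only, so that declared propositions have truth values and
-- declared endpoints are self-related is recorded separately, for the variable rule.
EntryOk : Ctx V → Class V K → Set
EntryOk Γ (ty A)            = ⊤
EntryOk {V} Γ (prf φ)       = {σ τ : Sub V []} → Env Γ σ τ → sub σ φ ∼[ Ω ] sub σ φ
EntryOk {V} Γ (M ＝⟨ A ⟩ N) =
  {σ τ : Sub V []} → Env Γ σ τ → sub σ M ∼[ A ] sub σ M × sub σ N ∼[ A ] sub σ N

CtxOk : Ctx V → Set
CtxOk ⟨⟩      = ⊤
CtxOk (Γ ▹ T) = CtxOk Γ × EntryOk Γ T

var-wellDefined : (Γ : Ctx V) → CtxOk Γ → (x : K ∈ V) {σ τ : Sub V []} →
                  Env Γ σ τ → WellDefined σ τ (var x) (lookup Γ x)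
var-wellDefined (Γ ▹ ty A) _ (here refl) (_ , r) = r
var-wellDefined (Γ ▹ prf φ) (_ , ok) (here refl) {σ} ρ =
  subst (λ φ → φ ∼[ Ω ] φ) (sub-wk σ φ) (ok ρ)
var-wellDefined (Γ ▹ M ＝⟨ A ⟩ N) (_ , ok) (here refl) {σ} ρ =
  subst (λ M → M ∼[ A ] M) (sub-wk σ M) (proj₁ (ok ρ)) ,
  subst (λ N → N ∼[ A ] N) (sub-wk σ N) (proj₂ (ok ρ))
var-wellDefined (Γ ▹ T) (ok , _) (there x) ρ =
  WellDefined-wk (lookup Γ x) x (var-wellDefined Γ ok x (Env-tail Γ T ρ))

var-holds : (Γ : Ctx V) (x : K ∈ V) {σ : Sub V W} →
            Hyps Γ σ → Holds σ (lookup Γ x)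
var-holds (Γ ▹ T) (here refl) (_ , h) = Holds-wk T h
var-holds (Γ ▹ T) (there x)   (h , _) = Holds-wk (lookup Γ x) (var-holds Γ x h)

⊃-∼ : {φ φ′ ψ ψ′ : Term V} →
      φ ∼[ Ω ] φ′ → ψ ∼[ Ω ] ψ′ → φ ⊃ ψ ∼[ Ω ] φ′ ⊃ ψ′
⊃-∼ (_ , d , d′) (_ , e , e′) = _ , ⇓⊃ d e , ⇓⊃ d′ e′

⊃-∼-inv : {φ ψ : Term V} → φ ⊃ ψ ∼[ Ω ] φ ⊃ ψ → φ ∼[ Ω ] φ × ψ ∼[ Ω ] ψ
⊃-∼-inv (_ , d , _) with ⇓⊃-inv d
... | _ , _ , d₁ , d₂ , _ = (_ , d₁ , d₁) , (_ , d₂ , d₂)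

∼-ƛ : (σ τ : Sub V W) (M M′ : Term (term ∷ V)) {N N′ : Term W} →
      sub (σ ▸ N) M ∼[ B ] sub (τ ▸ N′) M′ →
      sub σ (ƛ A M) · N ∼[ B ] sub τ (ƛ A M′) · N′
∼-ƛ {B = B} σ τ M M′ {N} {N′} r =
  ∼-⟵ B β (∼-sym B (∼-⟵ B β (∼-sym B
    (subst₂ _∼[ B ]_ (sym (lifts-inst σ N M)) (sym (lifts-inst τ N′ M′)) r))))

mutual

  valid-ok : {Γ : Ctx V} → Γ ⊢valid → CtxOk Γ
  valid-ok ⟨⟩-valid         = tt
  valid-ok (ty-valid v)     = valid-ok v , tt
  valid-ok (prf-valid d)    = ctx-ok d , λ ρ → ∼-reflˡ Ω (wellDefined d ρ)
  valid-ok (path-valid {A = A} d e) =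
    ctx-ok d , λ ρ → ∼-reflˡ A (wellDefined d ρ) , ∼-reflˡ A (wellDefined e ρ)

  -- The rule `⊢Λ` has no premise typing `φ`; its truth value is recovered from the context of the
  -- body. Hence the mutual induction with `wellDefined`.
  ctx-ok : {Γ : Ctx V} {E : Expr V K} {T : Class V K} → Γ ⊢ E ∶ T → CtxOk Γ
  ctx-ok (⊢var v x)         = valid-ok v
  ctx-ok (⊢⊥ v)             = valid-ok v
  ctx-ok (⊢⊃ d e)           = ctx-ok d
  ctx-ok (⊢· d e)           = ctx-ok d
  ctx-ok (⊢ƛ d)             = proj₁ (ctx-ok d)
  ctx-ok (⊢∙ d e)           = ctx-ok d
  ctx-ok (⊢Λ d)             = proj₁ (ctx-ok d)
  ctx-ok (⊢convₚ d e r)     = ctx-ok d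
  ctx-ok (⊢ref d)           = ctx-ok d
  ctx-ok (⊢⊃* d e)          = ctx-ok d
  ctx-ok (⊢univ d e)        = ctx-ok d
  ctx-ok (⊢⁺ d)             = ctx-ok d
  ctx-ok (⊢⁻ d)             = ctx-ok d
  ctx-ok (⊢λλλ d e f)       = ctx-ok e
  ctx-ok (⊢app* d e f g)    = ctx-ok d
  ctx-ok (⊢conv d e f r s)  = ctx-ok d

  wellDefined : {Γ : Ctx V} {E : Expr V K} {T : Class V K} {σ τ : Sub V []} →
                Γ ⊢ E ∶ T → Env Γ σ τ → WellDefined σ τ E T
  wellDefined {Γ = Γ} (⊢var v x) ρ = var-wellDefined Γ (valid-ok v) x ρ
  wellDefined (⊢⊥ v)   ρ = _ , ⇓⊥ , ⇓⊥
  wellDefined (⊢⊃ d e) ρ = ⊃-∼ (wellDefined d ρ) (wellDefined e ρ)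
  wellDefined (⊢· d e) ρ = wellDefined d ρ (wellDefined e ρ)
  wellDefined {σ = σ} {τ} (⊢ƛ {M = M} d) ρ {N} {N′} r =
    ∼-ƛ σ τ M M (wellDefined {σ = σ ▸ N} {τ ▸ N′} d (ρ , r))
  wellDefined (⊢∙ d e) ρ = proj₂ (⊃-∼-inv (wellDefined d ρ))
  wellDefined {σ = σ} {τ} (⊢Λ {ψ = ψ} d) ρ =
    ⊃-∼ (proj₂ (ctx-ok d) ρ)
        (subst (λ ψ → ψ ∼[ Ω ] ψ) (sym (sub-wk (skip σ) ψ))
               (wellDefined {σ = skip σ} {skip τ} d ρ))
  wellDefined (⊢convₚ d e r) ρ = ∼-reflˡ Ω (wellDefined e ρ)
  wellDefined (⊢ref {A = A} d) ρ with ∼-reflˡ A (wellDefined d ρ)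
  ... | M = M , M
  wellDefined (⊢⊃* d e) ρ with wellDefined d ρ | wellDefined e ρ
  ... | φ , φ′ | ψ , ψ′ = ⊃-∼ φ ψ , ⊃-∼ φ′ ψ′
  wellDefined (⊢univ d e) ρ = ⊃-∼-inv (wellDefined d ρ)
  wellDefined (⊢⁺ d) ρ with wellDefined d ρ
  ... | φ , ψ = ⊃-∼ φ ψ
  wellDefined (⊢⁻ d) ρ with wellDefined d ρ
  ... | φ , ψ = ⊃-∼ ψ φ
  wellDefined (⊢λλλ {A = A} {B = B} d e f) ρ =
    ∼-reflˡ (A ⇒ B) (wellDefined e ρ) , ∼-reflˡ (A ⇒ B) (wellDefined f ρ)
  wellDefined (⊢app* {A = A} d e f g) ρ with wellDefined d ρ
  ... | M , M′ = M (∼-reflˡ A (wellDefined f ρ)) , M′ (∼-reflˡ A (wellDefined g ρ))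
  wellDefined (⊢conv {A = A} d e f r s) ρ =
    ∼-reflˡ A (wellDefined e ρ) , ∼-reflˡ A (wellDefined f ρ)

∼⇒⇓⊃ : {φ ψ : Term V} → φ ∼[ Ω ] ψ → φ ⊃ ψ ⇓ true
∼⇒⇓⊃ (false , d , e) = ⇓⊃ d e
∼⇒⇓⊃ (true  , d , e) = ⇓⊃ d e

-- Propositional extensionality, for `univ`. The values true and false for `φ` and `ψ` would make
-- `φ ⊃ ψ` false.
⇓⊃⇒∼ : {φ ψ : Term V} → φ ⊃ ψ ⇓ true → ψ ⊃ φ ⇓ true → φ ∼[ Ω ] ψ
⇓⊃⇒∼ d e with ⇓⊃-inv d
... | false , false , f , g , _ = false , f , g
... | true  , true  , f , g , _ = true  , f , g
-- Modus ponens with the converse implication makes `φ` true as well.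
... | false , true  , f , g , _ = true  , ⇓-mp e g , g

sound : {Γ : Ctx V} {E : Expr V K} {T : Class V K} {σ : Sub V []} →
        Γ ⊢ E ∶ T → Env Γ σ σ → Hyps Γ σ → Holds σ T
sound {Γ = Γ} (⊢var v x) ρ h = var-holds Γ x h
sound (⊢⊥ v)   ρ h = tt
sound (⊢⊃ d e) ρ h = tt
sound (⊢· d e) ρ h = tt
sound (⊢ƛ d)   ρ h = tt
sound (⊢∙ d e) ρ h = ⇓-mp (sound d ρ h) (sound e ρ h)
sound {σ = σ} (⊢Λ {ψ = ψ} d) ρ h with proj₂ (ctx-ok d) ρ
... | true , φ , _ =
  ⇓⊃ φ (subst (_⇓ true) (sym (sub-wk (skip σ) ψ)) (sound {σ = skip σ} d ρ (h , φ)))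
-- The hypothesis fails, so `sound` cannot be applied to the body; any value `c` of `ψ` will do,
-- since `not false ∨ c` computes to `true`.
... | false , φ , _ with wellDefined {σ = skip σ} {skip σ} d ρ
...   | c , ψ⇓ , _ = ⇓⊃ φ (subst (_⇓ c) (sym (sub-wk (skip σ) ψ)) ψ⇓)
sound {σ = σ} (⊢convₚ d e r) ρ h = ⇓-≃ (sub-≃ σ r) (sound d ρ h)
sound (⊢ref d) ρ h = wellDefined d ρ
sound (⊢⊃* d e) ρ h = ⊃-∼ (sound d ρ h) (sound e ρ h)
sound (⊢univ d e) ρ h = ⇓⊃⇒∼ (sound d ρ h) (sound e ρ h)
sound (⊢⁺ d) ρ h = ∼⇒⇓⊃ (sound d ρ h)
sound (⊢⁻ d) ρ h = ∼⇒⇓⊃ (∼-sym Ω (sound d ρ h))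
sound {σ = σ} (⊢λλλ {A = A} {M = M} {B = B} {N = N} d e f) ρ h {L} {L′} r =
  -- A single environment sends x to `L` and y to `L′`; the hypothesis on e is then exactly `r`.
  subst₂ (λ M N → M · L ∼[ B ] N · L′) (sub-wk₃ M) (sub-wk₃ N)
    (sound {σ = σ′} d ((ρ , ∼-reflˡ A r) , ∼-reflʳ A r) (((h , tt) , tt) , r))
  where
  σ′ = skip {K = path} (σ ▸ L ▸ L′)

  sub-wk₃ : ∀ M → sub σ′ (wk (wk (wk M))) ≡ sub σ M
  sub-wk₃ M =
    trans (sub-ren (λ _ → refl) (wk (wk M)))
          (trans (sub-ren (λ _ → refl) (wk M)) (sub-ren (λ _ → refl) M))
sound (⊢app* d e f g) ρ h = sound d ρ h (sound e ρ h)
sound {σ = σ} (⊢conv {A = A} d e f r s) ρ h =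
  ∼-≃ A (sub-≃ σ r) (sub-≃ σ s) (sound d ρ h)

corollary41 : ¬ (Σ[ δ ∈ Proof [] ] ⟨⟩ ⊢ δ ∶ prf ⊥′)
corollary41 (_ , d) with ⇓-det (sound {σ = λ ()} d tt tt) ⇓⊥
... | ()
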